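{- Let $P(x)$ be a polynomial with real coefficients. Then there exists a triple of polynomials $(F_1(x),G_1(x),H_1(x))$ with real coefficients such that $$2\sum_{k=1}^{n}P(k)s_{k-1}=F_1(n)s_{n+1}+G_1(n)s_n+H_1(n)\qquad\text{for all } n\in\mathbb N.$$
   Context: $\mathbb N$ denotes the positive integers. Fix $a,b\in\mathbb N$ and $c_0,c_1\in\mathbb Z$ with $(c_0,c_1)\neq(0,0)$. The generalized Fibonacci sequence $(s_n)_{n\ge0}$ is defined by $s_0=c_0$, $s_1=c_1$, and $s_{n+1}=as_n+bs_{n-1}$ for all $n\in\mathbb N$. -}

module Defs where

open import Algebra.Bundles using (CommutativeRing)
open import Data.Fin.Base using (toℕ)
open import Data.Integer.Base as ℤ using (ℤ)
open import Data.List.Base using (List; []; _∷_)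
open import Data.Nat.Base as ℕ using (ℕ; zero; suc; _≥_; _⊔_)
import Data.Nat.Properties as ℕ
open import Data.Product.Base using (∃-syntax; _,_)
open import Data.Rational.Base as ℚ using (ℚ; 0ℚ; 1ℚ; ½; ∣_∣; Positive)
import Data.Rational.Properties as ℚ
open import Data.Rational.Solver using (module +-*-Solver)
open import Level using (0ℓ)
open import Relation.Binary.PropositionalEquality as ≡ using (_≡_)

------------------------------------------------------------------------
-- Real numbers: Cauchy sequences of rationals, modulo null sequences.
-- There are no quotient types, so ℝ is a setoid with equality _≈_.

IsCauchy : (ℕ → ℚ) → Set
IsCauchy x = ∀ ε → .{{Positive ε}} →
  ∃[ N ] (∀ m n → m ≥ N → n ≥ N → ∣ x m ℚ.- x n ∣ ℚ.< ε)

record ℝ : Set where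
  constructor mkℝ
  field
    seq    : ℕ → ℚ
    cauchy : IsCauchy seq

open ℝ public

infix 4 _≈_

-- A record rather than a function, so that x and y can be inferred
-- from a proof of x ≈ y.
record _≈_ (x y : ℝ) : Set where
  constructor mk≈
  field
    close : ∀ ε → .{{Positive ε}} →
      ∃[ N ] (∀ n → n ≥ N → ∣ seq x n ℚ.- seq y n ∣ ℚ.< ε)

open _≈_ public

private

  half-pos : ∀ ε → .{{Positive ε}} → Positive (½ ℚ.* ε)
  half-pos ε = ℚ.pos*pos⇒pos ½ ε

  half+half : ∀ ε → ½ ℚ.* ε ℚ.+ ½ ℚ.* ε ≡ ε
  half+half ε = begin
    ½ ℚ.* ε ℚ.+ ½ ℚ.* ε   ≡⟨ ℚ.*-distribʳ-+ ε ½ ½ ⟨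
    (½ ℚ.+ ½) ℚ.* ε       ≡⟨ ≡.cong (ℚ._* ε) ½+½≡1 ⟩
    1ℚ ℚ.* ε              ≡⟨ ℚ.*-identityˡ ε ⟩
    ε                     ∎
    where
    open ≡.≡-Reasoning
    ½+½≡1 : ½ ℚ.+ ½ ≡ 1ℚ
    ½+½≡1 = ≡.refl

  p-p≡0 : ∀ p → ∣ p ℚ.- p ∣ ≡ 0ℚ
  p-p≡0 p = ≡.cong ∣_∣ (ℚ.+-inverseʳ p)

  p-p<ε : ∀ p ε → .{{Positive ε}} → ∣ p ℚ.- p ∣ ℚ.< ε
  p-p<ε p ε = ≡.subst (ℚ._< ε) (≡.sym (p-p≡0 p)) (ℚ.positive⁻¹ ε)

  swap : ∀ p q → ∣ p ℚ.- q ∣ ≡ ∣ q ℚ.- p ∣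
  swap p q = ≡.trans (≡.cong ∣_∣ eq) (ℚ.∣-p∣≡∣p∣ (q ℚ.- p))
    where
    open +-*-Solver
    eq : p ℚ.- q ≡ ℚ.- (q ℚ.- p)
    eq = solve 2 (λ p q → p :- q := :- (q :- p)) ≡.refl p q

  +-close : ∀ p p′ q q′ ε → ∣ p ℚ.- p′ ∣ ℚ.< ½ ℚ.* ε → ∣ q ℚ.- q′ ∣ ℚ.< ½ ℚ.* ε →
            ∣ (p ℚ.+ q) ℚ.- (p′ ℚ.+ q′) ∣ ℚ.< ε
  +-close p p′ q q′ ε p< q< = begin-strict
    ∣ (p ℚ.+ q) ℚ.- (p′ ℚ.+ q′) ∣      ≡⟨ ≡.cong ∣_∣ eq ⟩
    ∣ (p ℚ.- p′) ℚ.+ (q ℚ.- q′) ∣      ≤⟨ ℚ.∣p+q∣≤∣p∣+∣q∣ (p ℚ.- p′) (q ℚ.- q′) ⟩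
    ∣ p ℚ.- p′ ∣ ℚ.+ ∣ q ℚ.- q′ ∣      <⟨ ℚ.+-mono-< p< q< ⟩
    ½ ℚ.* ε ℚ.+ ½ ℚ.* ε                ≡⟨ half+half ε ⟩
    ε                                  ∎
    where
    open ℚ.≤-Reasoning
    open +-*-Solver
    eq : (p ℚ.+ q) ℚ.- (p′ ℚ.+ q′) ≡ (p ℚ.- p′) ℚ.+ (q ℚ.- q′)
    eq = solve 4 (λ p p′ q q′ → (p :+ q) :- (p′ :+ q′) := (p :- p′) :+ (q :- q′))
           ≡.refl p p′ q q′

  neg-close : ∀ p p′ → ∣ (ℚ.- p) ℚ.- (ℚ.- p′) ∣ ≡ ∣ p ℚ.- p′ ∣
  neg-close p p′ = ≡.trans (≡.cong ∣_∣ (≡.sym (ℚ.neg-distrib-+ p (ℚ.- p′))))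
                           (ℚ.∣-p∣≡∣p∣ (p ℚ.- p′))

  tri-close : ∀ p q r ε → ∣ p ℚ.- q ∣ ℚ.< ½ ℚ.* ε → ∣ q ℚ.- r ∣ ℚ.< ½ ℚ.* ε →
              ∣ p ℚ.- r ∣ ℚ.< ε
  tri-close p q r ε p< q< =
    ≡.subst (λ t → ∣ t ∣ ℚ.< ε) eq (+-close p q q r ε p< q<)
    where
    open +-*-Solver
    eq : (p ℚ.+ q) ℚ.- (q ℚ.+ r) ≡ p ℚ.- r
    eq = solve 3 (λ p q r → (p :+ q) :- (q :+ r) := p :- r) ≡.refl p q r

  -- If ∣x∣ and ∣y∣ are below K, it is enough that factors agree up to ε / 2K.
  tol : (K ε : ℚ) → .{{Positive K}} → ℚ
  tol K ε = ½ ℚ.* ((ℚ.1/ K) {{ℚ.pos⇒nonZero K}} ℚ.* ε)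

  tol-pos : ∀ K ε → .{{_ : Positive K}} → .{{Positive ε}} → Positive (tol K ε)
  tol-pos K ε = half-pos (1/K ℚ.* ε) {{ℚ.pos*pos⇒pos 1/K {{ℚ.1/pos⇒pos K}} ε}}
    where 1/K = (ℚ.1/ K) {{ℚ.pos⇒nonZero K}}

  K*tol : ∀ K ε → .{{_ : Positive K}} → K ℚ.* tol K ε ≡ ½ ℚ.* ε
  K*tol K ε = begin
    K ℚ.* (½ ℚ.* (1/K ℚ.* ε))    ≡⟨ solve 4 (λ K h i ε → K :* (h :* (i :* ε)) := h :* ((K :* i) :* ε))
                                          ≡.refl K ½ 1/K ε ⟩
    ½ ℚ.* ((K ℚ.* 1/K) ℚ.* ε)    ≡⟨ ≡.cong (λ t → ½ ℚ.* (t ℚ.* ε)) (ℚ.*-inverseʳ K {{ℚ.pos⇒nonZero K}}) ⟩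
    ½ ℚ.* (1ℚ ℚ.* ε)             ≡⟨ ≡.cong (½ ℚ.*_) (ℚ.*-identityˡ ε) ⟩
    ½ ℚ.* ε                      ∎
    where
    open ≡.≡-Reasoning
    open +-*-Solver
    1/K = (ℚ.1/ K) {{ℚ.pos⇒nonZero K}}

  half-*-close : ∀ K ε → .{{_ : Positive K}} → ∀ p q →
                 ∣ p ∣ ℚ.< K → ∣ q ∣ ℚ.< tol K ε → ∣ p ℚ.* q ∣ ℚ.< ½ ℚ.* ε
  half-*-close K ε p q p< q< = begin-strict
    ∣ p ℚ.* q ∣         ≡⟨ ℚ.∣p*q∣≡∣p∣*∣q∣ p q ⟩
    ∣ p ∣ ℚ.* ∣ q ∣     ≤⟨ ℚ.*-monoʳ-≤-nonNeg ∣ q ∣ {{ℚ.∣-∣-nonNeg q}} (ℚ.<⇒≤ p<) ⟩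
    K ℚ.* ∣ q ∣         <⟨ ℚ.*-monoʳ-<-pos K q< ⟩
    K ℚ.* tol K ε       ≡⟨ K*tol K ε ⟩
    ½ ℚ.* ε             ∎
    where open ℚ.≤-Reasoning

  *-close : ∀ K ε → .{{_ : Positive K}} → ∀ p p′ q q′ → ∣ p ∣ ℚ.< K → ∣ q′ ∣ ℚ.< K →
            ∣ p ℚ.- p′ ∣ ℚ.< tol K ε → ∣ q ℚ.- q′ ∣ ℚ.< tol K ε →
            ∣ p ℚ.* q ℚ.- p′ ℚ.* q′ ∣ ℚ.< ε
  *-close K ε p p′ q q′ p<K q′<K p< q< = begin-strict
    ∣ p ℚ.* q ℚ.- p′ ℚ.* q′ ∣                               ≡⟨ ≡.cong ∣_∣ eq ⟩
    ∣ p ℚ.* (q ℚ.- q′) ℚ.+ q′ ℚ.* (p ℚ.- p′) ∣              ≤⟨ ℚ.∣p+q∣≤∣p∣+∣q∣ (p ℚ.* (q ℚ.- q′)) (q′ ℚ.* (p ℚ.- p′)) ⟩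
    ∣ p ℚ.* (q ℚ.- q′) ∣ ℚ.+ ∣ q′ ℚ.* (p ℚ.- p′) ∣          <⟨ ℚ.+-mono-< (half-*-close K ε p (q ℚ.- q′) p<K q<)
                                                                          (half-*-close K ε q′ (p ℚ.- p′) q′<K p<) ⟩
    ½ ℚ.* ε ℚ.+ ½ ℚ.* ε                                     ≡⟨ half+half ε ⟩
    ε                                                       ∎
    where
    open ℚ.≤-Reasoning
    open +-*-Solver
    eq : p ℚ.* q ℚ.- p′ ℚ.* q′ ≡ p ℚ.* (q ℚ.- q′) ℚ.+ q′ ℚ.* (p ℚ.- p′)
    eq = solve 4 (λ p p′ q q′ → p :* q :- p′ :* q′ := p :* (q :- q′) :+ q′ :* (p :- p′))
           ≡.refl p p′ q q′

  record Bound (x y : ℝ) : Set where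
    constructor mkBound
    field
      K     : ℚ
      .{{pos}} : Positive K
      N     : ℕ
      x<K   : ∀ n → n ≥ N → ∣ seq x n ∣ ℚ.< K
      y<K   : ∀ n → n ≥ N → ∣ seq y n ∣ ℚ.< K

  ∣p∣≤∣p-q∣+∣q∣ : ∀ p q → ∣ p ∣ ℚ.≤ ∣ p ℚ.- q ∣ ℚ.+ ∣ q ∣
  ∣p∣≤∣p-q∣+∣q∣ p q = ≡.subst (λ t → ∣ t ∣ ℚ.≤ ∣ p ℚ.- q ∣ ℚ.+ ∣ q ∣) eq
                              (ℚ.∣p+q∣≤∣p∣+∣q∣ (p ℚ.- q) q)
    where
    open +-*-Solver
    eq : (p ℚ.- q) ℚ.+ q ≡ p
    eq = solve 2 (λ p q → (p :- q) :+ q := p) ≡.refl p q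

  <-slack : ∀ p q d C → .{{ℚ.NonNegative C}} → ∣ p ℚ.- q ∣ ℚ.< d → ∣ p ∣ ℚ.< d ℚ.+ (∣ q ∣ ℚ.+ C)
  <-slack p q d C p< = begin-strict
    ∣ p ∣                         ≤⟨ ∣p∣≤∣p-q∣+∣q∣ p q ⟩
    ∣ p ℚ.- q ∣ ℚ.+ ∣ q ∣         <⟨ ℚ.+-monoˡ-< ∣ q ∣ p< ⟩
    d ℚ.+ ∣ q ∣                   ≡⟨ ≡.cong (d ℚ.+_) (ℚ.+-identityʳ ∣ q ∣) ⟨
    d ℚ.+ (∣ q ∣ ℚ.+ 0ℚ)          ≤⟨ ℚ.+-monoʳ-≤ d (ℚ.+-monoʳ-≤ ∣ q ∣ (ℚ.nonNegative⁻¹ C)) ⟩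
    d ℚ.+ (∣ q ∣ ℚ.+ C)           ∎
    where open ℚ.≤-Reasoning

  bound : ∀ x y → Bound x y
  bound x y with cauchy x 1ℚ | cauchy y 1ℚ
  ... | M , p | N , q = mkBound (1ℚ ℚ.+ (A ℚ.+ B)) {{K-pos}} (M ⊔ N)
    (λ n n≥ → <-slack (seq x n) (seq x M) 1ℚ B {{ℚ.∣-∣-nonNeg (seq y N)}}
                (p n M (ℕ.m⊔n≤o⇒m≤o M N n≥) ℕ.≤-refl))
    (λ n n≥ → ≡.subst (λ t → ∣ seq y n ∣ ℚ.< 1ℚ ℚ.+ t) (ℚ.+-comm B A)
                (<-slack (seq y n) (seq y N) 1ℚ A {{ℚ.∣-∣-nonNeg (seq x M)}}
                  (q n N (ℕ.m⊔n≤o⇒n≤o M N n≥) ℕ.≤-refl)))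
    where
    A = ∣ seq x M ∣
    B = ∣ seq y N ∣
    K-pos : Positive (1ℚ ℚ.+ (A ℚ.+ B))
    K-pos = ℚ.pos+nonNeg⇒pos 1ℚ (A ℚ.+ B)
              {{ℚ.nonNeg+nonNeg⇒nonNeg A {{ℚ.∣-∣-nonNeg (seq x M)}} B {{ℚ.∣-∣-nonNeg (seq y N)}}}}

------------------------------------------------------------------------

fromℚ : ℚ → ℝ
fromℚ p = mkℝ (λ _ → p) (λ ε → 0 , λ _ _ _ _ → p-p<ε p ε)

fromℤ : ℤ → ℝ
fromℤ z = fromℚ (z ℚ./ 1)

fromℕ : ℕ → ℝ
fromℕ n = fromℤ (ℤ.+ n)

0ℝ 1ℝ : ℝ
0ℝ = fromℚ 0ℚ
1ℝ = fromℚ 1ℚ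

infixl 6 _+_
infixl 7 _*_
infix  8 -_

_+_ : ℝ → ℝ → ℝ
seq    (x + y) n = seq x n ℚ.+ seq y n
cauchy (x + y) ε =
  let (M , p) = cauchy x (½ ℚ.* ε) {{half-pos ε}}
      (N , q) = cauchy y (½ ℚ.* ε) {{half-pos ε}}
  in M ⊔ N , λ m n m≥ n≥ → +-close (seq x m) (seq x n) (seq y m) (seq y n) ε
    (p m n (ℕ.m⊔n≤o⇒m≤o M N m≥) (ℕ.m⊔n≤o⇒m≤o M N n≥))
    (q m n (ℕ.m⊔n≤o⇒n≤o M N m≥) (ℕ.m⊔n≤o⇒n≤o M N n≥))

-_ : ℝ → ℝ
seq    (- x) n = ℚ.- seq x n
cauchy (- x) ε = let (N , p) = cauchy x ε in N , λ m n m≥ n≥ →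
  ≡.subst (ℚ._< ε) (≡.sym (neg-close (seq x m) (seq x n))) (p m n m≥ n≥)

_*_ : ℝ → ℝ → ℝ
seq    (x * y) n = seq x n ℚ.* seq y n
cauchy (x * y) ε =
  let mkBound K L x<K y<K = bound x y
      (M , p) = cauchy x (tol K ε) {{tol-pos K ε}}
      (N , q) = cauchy y (tol K ε) {{tol-pos K ε}}
  in L ⊔ (M ⊔ N) , λ m n m≥ n≥ →
    let m≥MN = ℕ.m⊔n≤o⇒n≤o L (M ⊔ N) m≥
        n≥MN = ℕ.m⊔n≤o⇒n≤o L (M ⊔ N) n≥
    in *-close K ε (seq x m) (seq x n) (seq y m) (seq y n)
         (x<K m (ℕ.m⊔n≤o⇒m≤o L (M ⊔ N) m≥)) (y<K n (ℕ.m⊔n≤o⇒m≤o L (M ⊔ N) n≥))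
         (p m n (ℕ.m⊔n≤o⇒m≤o M N m≥MN) (ℕ.m⊔n≤o⇒m≤o M N n≥MN))
         (q m n (ℕ.m⊔n≤o⇒n≤o M N m≥MN) (ℕ.m⊔n≤o⇒n≤o M N n≥MN))

pointwise : ∀ {x y} → (∀ n → seq x n ≡ seq y n) → x ≈ y
pointwise {x} {y} eq = mk≈ λ ε → 0 , λ n _ →
  ≡.subst (λ t → ∣ seq x n ℚ.- t ∣ ℚ.< ε) (eq n) (p-p<ε (seq x n) ε)

≈-refl : ∀ {x} → x ≈ x
≈-refl = pointwise (λ _ → ≡.refl)

≈-sym : ∀ {x y} → x ≈ y → y ≈ x
≈-sym {x} {y} (mk≈ f) = mk≈ λ ε → let (N , p) = f ε in N , λ n n≥ →
  ≡.subst (ℚ._< ε) (swap (seq x n) (seq y n)) (p n n≥)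

≈-trans : ∀ {x y z} → x ≈ y → y ≈ z → x ≈ z
≈-trans {x} {y} {z} (mk≈ f) (mk≈ g) = mk≈ λ ε →
  let (M , p) = f (½ ℚ.* ε) {{half-pos ε}}
      (N , q) = g (½ ℚ.* ε) {{half-pos ε}}
  in M ⊔ N , λ n n≥ → tri-close (seq x n) (seq y n) (seq z n) ε
       (p n (ℕ.m⊔n≤o⇒m≤o M N n≥)) (q n (ℕ.m⊔n≤o⇒n≤o M N n≥))

+-cong : ∀ {x x′ y y′} → x ≈ x′ → y ≈ y′ → x + y ≈ x′ + y′
+-cong {x} {x′} {y} {y′} (mk≈ f) (mk≈ g) = mk≈ λ ε →
  let (M , p) = f (½ ℚ.* ε) {{half-pos ε}}
      (N , q) = g (½ ℚ.* ε) {{half-pos ε}}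
  in M ⊔ N , λ n n≥ → +-close (seq x n) (seq x′ n) (seq y n) (seq y′ n) ε
       (p n (ℕ.m⊔n≤o⇒m≤o M N n≥)) (q n (ℕ.m⊔n≤o⇒n≤o M N n≥))

-‿cong : ∀ {x x′} → x ≈ x′ → - x ≈ - x′
-‿cong {x} {x′} (mk≈ f) = mk≈ λ ε → let (N , p) = f ε in N , λ n n≥ →
  ≡.subst (ℚ._< ε) (≡.sym (neg-close (seq x n) (seq x′ n))) (p n n≥)

*-cong : ∀ {x x′ y y′} → x ≈ x′ → y ≈ y′ → x * y ≈ x′ * y′
*-cong {x} {x′} {y} {y′} (mk≈ f) (mk≈ g) = mk≈ λ ε →
  let mkBound K L x<K y′<K = bound x y′
      (M , p) = f (tol K ε) {{tol-pos K ε}}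
      (N , q) = g (tol K ε) {{tol-pos K ε}}
  in L ⊔ (M ⊔ N) , λ n n≥ →
    let n≥L  = ℕ.m⊔n≤o⇒m≤o L (M ⊔ N) n≥
        n≥MN = ℕ.m⊔n≤o⇒n≤o L (M ⊔ N) n≥
    in *-close K ε (seq x n) (seq x′ n) (seq y n) (seq y′ n) (x<K n n≥L) (y′<K n n≥L)
         (p n (ℕ.m⊔n≤o⇒m≤o M N n≥MN)) (q n (ℕ.m⊔n≤o⇒n≤o M N n≥MN))

ℝ-commutativeRing : CommutativeRing 0ℓ 0ℓ
ℝ-commutativeRing = record
  { Carrier = ℝ
  ; _≈_ = _≈_
  ; _+_ = _+_
  ; _*_ = _*_
  ; -_  = -_
  ; 0#  = 0ℝ
  ; 1#  = 1ℝ
  ; isCommutativeRing = record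
    { isRing = record
      { +-isAbelianGroup = record
        { isGroup = record
          { isMonoid = record
            { isSemigroup = record
              { isMagma = record
                { isEquivalence = record
                  { refl = ≈-refl ; sym = ≈-sym ; trans = ≈-trans }
                ; ∙-cong = +-cong
                }
              ; assoc = λ x y z → pointwise λ n → ℚ.+-assoc (seq x n) (seq y n) (seq z n)
              }
            ; identity = (λ x → pointwise λ n → ℚ.+-identityˡ (seq x n))
                       , (λ x → pointwise λ n → ℚ.+-identityʳ (seq x n))
            }
          ; inverse = (λ x → pointwise λ n → ℚ.+-inverseˡ (seq x n))
                    , (λ x → pointwise λ n → ℚ.+-inverseʳ (seq x n))
          ; ⁻¹-cong = -‿cong
          }
        ; comm = λ x y → pointwise λ n → ℚ.+-comm (seq x n) (seq y n)
        }
      ; *-cong = *-cong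
      ; *-assoc = λ x y z → pointwise λ n → ℚ.*-assoc (seq x n) (seq y n) (seq z n)
      ; *-identity = (λ x → pointwise λ n → ℚ.*-identityˡ (seq x n))
                   , (λ x → pointwise λ n → ℚ.*-identityʳ (seq x n))
      ; distrib = (λ x y z → pointwise λ n → ℚ.*-distribˡ-+ (seq x n) (seq y n) (seq z n))
                , (λ x y z → pointwise λ n → ℚ.*-distribʳ-+ (seq x n) (seq y n) (seq z n))
      }
    ; *-comm = λ x y → pointwise λ n → ℚ.*-comm (seq x n) (seq y n)
    }
  }

open import Algebra.Properties.CommutativeMonoid.Sum
  (CommutativeRing.+-commutativeMonoid ℝ-commutativeRing) using (sum-syntax)

-- ∑₁ n f = f 1 + ⋯ + f n
∑₁ : ℕ → (ℕ → ℝ) → ℝ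
∑₁ n f = ∑[ i < n ] f (suc (toℕ i))

------------------------------------------------------------------------

-- Coefficients, constant term first.  Trailing zeros are allowed: equality
-- with zero is undecidable on ℝ, so there is no normal form.
ℝ[X] : Set
ℝ[X] = List ℝ

infixl 9 _⟨_⟩

_⟨_⟩ : ℝ[X] → ℝ → ℝ
[]      ⟨ x ⟩ = 0ℝ
(c ∷ P) ⟨ x ⟩ = c + x * P ⟨ x ⟩

fib : (a b : ℕ) (c₀ c₁ : ℤ) → ℕ → ℤ
fib a b c₀ c₁ zero          = c₀
fib a b c₀ c₁ (suc zero)    = c₁
fib a b c₀ c₁ (suc (suc n)) =
  (ℤ.+ a) ℤ.* fib a b c₀ c₁ (suc n) ℤ.+ (ℤ.+ b) ℤ.* fib a b c₀ c₁ n

-- Let p k = P(k) and write A, B for the reals a, b.  If F is a polynomial with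
-- B F(m+2) + A F(m+1) = F(m) + 2 p(m+2) and G(m) = B F(m+1) − 2 p(m+1), then by
-- the recurrence for s the expression F(n) s(n+1) + G(n) s(n) grows by exactly
-- 2 p(n+1) s(n) from n to n + 1, so it differs from the sum by a constant.
-- Such an F exists because F ↦ B F(m+2) + A F(m+1) − F(m) multiplies leading
-- coefficients by A + B − 1 > 0 and is therefore surjective on the polynomials
-- of any bounded degree.
module Submission where

open import Algebra.Bundles using (CommutativeRing)
open import Data.Fin.Base using (toℕ)
open import Data.Integer.Base as ℤ using (ℤ; 0ℤ)
import Data.Integer.Properties as ℤ
open import Data.List.Base using (List; []; _∷_; length)
import Data.Nat.Coprimality as Coprimality
open import Data.Nat.Base using (ℕ; zero; suc; _∸_; NonZero)
open import Data.Product.Base using (∃-syntax; _×_; _,_)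
open import Data.Rational.Base as ℚ using (ℚ; mkℚ; 1ℚ)
import Data.Rational.Properties as ℚ
open import Function.Base using (_∘_)
import Level
open import Relation.Binary.PropositionalEquality as ≡ using (_≡_; _≢_)

-- The ring is a parameter: comparing sums and products of concrete reals
-- makes Agda unfold their Cauchy proofs.
module Summation {c ℓ} (R : CommutativeRing c ℓ) where

  open CommutativeRing R renaming (Carrier to K) hiding (zero)
  open import Algebra.Properties.CommutativeMonoid.Sum +-commutativeMonoid using (sum-syntax)
  open import Algebra.Solver.Ring.NaturalCoefficients.Default commutativeSemiring
    using (solve; con; _:=_; _:+_; _:*_)
  open import Relation.Binary.Reasoning.Setoid setoid

  ∑ : ℕ → (ℕ → K) → K
  ∑ n f = ∑[ i < n ] f (suc (toℕ i))

  -- `∑` unfolds at its first term, so the last term is reached by induction on the shifted summand.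
  ∑-suc : ∀ n f → ∑ (suc n) f ≈ ∑ n f + f (suc n)
  ∑-suc zero    f = +-comm (f 1) 0#
  ∑-suc (suc n) f = begin
    f 1 + ∑ (suc n) (f ∘ suc)                  ≈⟨ +-congˡ (∑-suc n (f ∘ suc)) ⟩
    f 1 + (∑ n (f ∘ suc) + f (suc (suc n)))    ≈⟨ +-assoc _ _ _ ⟨
    ∑ (suc n) f + f (suc (suc n))              ∎

  -- Polynomial sequences and their closure properties.

  module _ (ι : ℕ → K) (ι-suc : ∀ m → ι (suc m) ≈ 1# + ι m)
           (eval : List K → K → K) (eval-[] : ∀ x → eval [] x ≈ 0#)
           (eval-∷ : ∀ a P x → eval (a ∷ P) x ≈ a + x * eval P x) where

    -- Sequences m ↦ P (ι m) for a polynomial P with n coefficients, in Horner form.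
    data Polynomial : ℕ → (ℕ → K) → Set (c Level.⊔ ℓ) where
      null   : ∀ {f} → (∀ m → f m ≈ 0#) → Polynomial 0 f
      horner : ∀ {n f g} a → Polynomial n g → (∀ m → f m ≈ a + ι m * g m) → Polynomial (suc n) f

    eval-polynomial : ∀ P → Polynomial (length P) (eval P ∘ ι)
    eval-polynomial []      = null (eval-[] ∘ ι)
    eval-polynomial (a ∷ P) = horner a (eval-polynomial P) (eval-∷ a P ∘ ι)

    coefficients : ∀ {n f} → Polynomial n f → ∃[ P ] (∀ m → f m ≈ eval P (ι m))
    coefficients (null f≈0)       = [] , λ m → trans (f≈0 m) (sym (eval-[] (ι m)))
    coefficients (horner a Pg f≈) =
      let (P , g≈P) = coefficients Pg
      in a ∷ P , λ m → trans (f≈ m) (trans (+-congˡ (*-congˡ (g≈P m))) (sym (eval-∷ a P (ι m))))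

    -- Pads with a zero leading coefficient, because `polynomial-+` adds only sequences with equal
    -- coefficient counts.
    polynomial-weaken : ∀ {n f} → Polynomial n f → Polynomial (suc n) f
    polynomial-weaken (null f≈0) = horner 0# (null λ _ → refl) λ m → trans (f≈0 m)
      (solve 1 (λ x → con 0 := con 0 :+ x :* con 0) refl (ι m))
    polynomial-weaken (horner a Pg f≈) = horner a (polynomial-weaken Pg) f≈

    polynomial-+ : ∀ {n f g} → Polynomial n f → Polynomial n g → Polynomial n (λ m → f m + g m)
    polynomial-+ (null f≈0) (null g≈0) = null λ m → trans (+-cong (f≈0 m) (g≈0 m)) (+-identityʳ 0#)
    polynomial-+ (horner a Pf f≈) (horner b Pg g≈) =
      horner (a + b) (polynomial-+ Pf Pg) λ m → trans (+-cong (f≈ m) (g≈ m))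
        (solve 5 (λ a b x u v → (a :+ x :* u) :+ (b :+ x :* v) := (a :+ b) :+ x :* (u :+ v)) refl
          a b (ι m) _ _)

    polynomial-scale : ∀ {n f} r → Polynomial n f → Polynomial n (λ m → r * f m)
    polynomial-scale r (null f≈0) = null λ m → trans (*-congˡ (f≈0 m)) (zeroʳ r)
    polynomial-scale r (horner a Pg f≈) =
      horner (r * a) (polynomial-scale r Pg) λ m → trans (*-congˡ (f≈ m))
        (solve 4 (λ r a x u → r :* (a :+ x :* u) := r :* a :+ x :* (r :* u)) refl r a (ι m) _)

    polynomial-cong : ∀ {n f g} → (∀ m → f m ≈ g m) → Polynomial n g → Polynomial n f
    polynomial-cong f≈g (null g≈0)       = null λ m → trans (f≈g m) (g≈0 m)
    polynomial-cong f≈g (horner a Ph g≈) = horner a Ph λ m → trans (f≈g m) (g≈ m)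

    -- Replacing `x` by `1 + x` adds one extra copy of the shifted tail. The tail has one
    -- coefficient fewer, so the count does not grow.
    polynomial-shift : ∀ {n f} → Polynomial n f → Polynomial n (f ∘ suc)
    polynomial-shift (null f≈0) = null (f≈0 ∘ suc)
    polynomial-shift {f = f} (horner {g = g} a Pg f≈) = polynomial-cong
      (λ m → begin
        f (suc m)                                ≈⟨ f≈ (suc m) ⟩
        a + ι (suc m) * g (suc m)                ≈⟨ +-congˡ (*-congʳ (ι-suc m)) ⟩
        a + (1# + ι m) * g (suc m)               ≈⟨ solve 3 (λ a x u →
          a :+ (con 1 :+ x) :* u := (a :+ x :* u) :+ u) refl a (ι m) (g (suc m)) ⟩
        (a + ι m * g (suc m)) + g (suc m)        ∎)
      (polynomial-+ (horner a (polynomial-shift Pg) λ _ → refl) (polynomial-weaken (polynomial-shift Pg)))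

    -- The difference equation for `F`.

    module _ (A B : K) where

      -- For a solution F of the equation with right-hand side g, the sequence
      -- ι m * F m solves it with right-hand side ι m * g m + r m, where
      -- r m = 2 B F (m + 2) + A F (m + 1) has no more coefficients than F, so that
      -- r can be removed by a second use of the induction hypothesis.  The constant
      -- term needs e = (A + B − 1)⁻¹.
      inhomogeneous-solution : ∀ {n f} e → (A + B) * e ≈ 1# + e → Polynomial n f →
        ∃[ F ] Polynomial n F × (∀ m → B * F (suc (suc m)) + A * F (suc m) ≈ F m + f m)
      inhomogeneous-solution e inv (null f≈0) = (λ _ → 0#) , null (λ _ → refl) , λ m → trans
        (solve 2 (λ A B → B :* con 0 :+ A :* con 0 := con 0 :+ con 0) refl A B)
        (+-congˡ (sym (f≈0 m)))
      inhomogeneous-solution {suc n} {f} e inv (horner {g = g} a Pg f≈)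
        with inhomogeneous-solution e inv Pg
      ... | F , PF , F-solves
        -- `PF` has `n` coefficients, so the recursion descends from `suc n` to `n` although this
        -- argument is not a subterm of the input.
        with inhomogeneous-solution e inv (polynomial-scale (- 1#)
               (polynomial-+ (polynomial-scale ((1# + 1#) * B) (polynomial-shift (polynomial-shift PF)))
                             (polynomial-scale A (polynomial-shift PF))))
      ... | N , PN , N-solves = S , PS , S-solves
        where
        S r : ℕ → K
        S m = (a * e + ι m * F m) + N m
        r m = (1# + 1#) * B * F (suc (suc m)) + A * F (suc m)

        PS : Polynomial (suc n) S
        PS = polynomial-+ (horner (a * e) PF λ _ → refl) (polynomial-weaken PN)

        S-solves : ∀ m → B * S (suc (suc m)) + A * S (suc m) ≈ S m + f m
        S-solves m = begin
          B * S (suc (suc m)) + A * S (suc m)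
            ≈⟨ +-cong
                 (*-congˡ (+-congʳ (+-congˡ (*-congʳ (trans (ι-suc (suc m)) (+-congˡ (ι-suc m)))))))
                 (*-congˡ (+-congʳ (+-congˡ (*-congʳ (ι-suc m))))) ⟩
          B * ((a * e + (1# + (1# + x)) * F₂) + N₂) + A * ((a * e + (1# + x) * F₁) + N₁)
            -- Isolates the left-hand sides of `inv`, `F-solves` and `N-solves`; the increments 2
            -- and 1 of `x` leave `r m` over.
            ≈⟨ solve 9 (λ A B a e x F₁ F₂ N₁ N₂ →
                 B :* ((a :* e :+ (con 1 :+ (con 1 :+ x)) :* F₂) :+ N₂)
                   :+ A :* ((a :* e :+ (con 1 :+ x) :* F₁) :+ N₁)
                 := ((a :* ((A :+ B) :* e) :+ x :* (B :* F₂ :+ A :* F₁)) :+ (B :* N₂ :+ A :* N₁))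
                    :+ ((con 1 :+ con 1) :* B :* F₂ :+ A :* F₁))
                 refl A B a e x F₁ F₂ N₁ N₂ ⟩
          ((a * ((A + B) * e) + x * (B * F₂ + A * F₁)) + (B * N₂ + A * N₁)) + r m
            ≈⟨ +-congʳ (+-cong (+-cong (*-congˡ inv) (*-congˡ (F-solves m))) (N-solves m)) ⟩
          ((a * (1# + e) + x * (F m + g m)) + (N m + - 1# * r m)) + r m
            -- The semiring solver sees `- 1#` as a variable `ν`; the remaining factor `1 + ν` is
            -- zero by the next step.
            ≈⟨ solve 8 (λ a e x F₀ g N₀ ν r →
                 ((a :* (con 1 :+ e) :+ x :* (F₀ :+ g)) :+ (N₀ :+ ν :* r)) :+ r
                 := (((a :* e :+ x :* F₀) :+ N₀) :+ (a :+ x :* g)) :+ (con 1 :+ ν) :* r)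
                 refl a e x (F m) (g m) (N m) (- 1#) (r m) ⟩
          (S m + (a + x * g m)) + (1# + - 1#) * r m
            ≈⟨ +-cong (+-congˡ (sym (f≈ m))) (trans (*-congʳ (-‿inverseʳ 1#)) (zeroˡ (r m))) ⟩
          (S m + f m) + 0#
            ≈⟨ +-identityʳ _ ⟩
          S m + f m ∎
          where
          x  = ι m
          F₁ = F (suc m)
          F₂ = F (suc (suc m))
          N₁ = N (suc m)
          N₂ = N (suc (suc m))

      -- Summation along a second-order recurrence.

      module _ (s p F : ℕ → K) (u : K)
        (s-rec : ∀ n → s (suc (suc n)) ≈ A * s (suc n) + B * s n)
        (F-solves : ∀ m → B * F (suc (suc m)) + A * F (suc m) ≈ F m + u * p (suc (suc m)))
        where

        G : ℕ → K
        G m = B * F (suc m) + - 1# * (u * p (suc m))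

        -- The constant is forced by `n = 0`, where the sum is empty.
        H : K
        H = - (F 0 * s 1 + G 0 * s 0)

        summation : ∀ n → u * ∑ n (λ k → p k * s (k ∸ 1)) ≈ F n * s (suc n) + G n * s n + H
        summation zero    = trans (zeroʳ u) (sym (-‿inverseʳ (F 0 * s 1 + G 0 * s 0)))
        summation (suc n) = begin
          u * ∑ (suc n) t
            ≈⟨ *-congˡ (∑-suc n t) ⟩
          u * (∑ n t + p₁ * s₀)
            ≈⟨ distribˡ u _ _ ⟩
          u * ∑ n t + u * (p₁ * s₀)
            ≈⟨ +-congʳ (summation n) ⟩
          (F₀ * s₁ + G n * s₀ + H) + u * (p₁ * s₀)
            ≈⟨ solve 9 (λ B F₀ F₁ s₀ s₁ p₁ u ν H →
                 (F₀ :* s₁ :+ (B :* F₁ :+ ν :* (u :* p₁)) :* s₀ :+ H) :+ u :* (p₁ :* s₀)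
                 := (F₀ :* s₁ :+ B :* F₁ :* s₀ :+ H) :+ (con 1 :+ ν) :* (u :* p₁ :* s₀))
                 refl B F₀ F₁ s₀ s₁ p₁ u (- 1#) H ⟩
          (F₀ * s₁ + B * F₁ * s₀ + H) + (1# + - 1#) * (u * p₁ * s₀)
            ≈⟨ +-congˡ (trans (*-congʳ (-‿inverseʳ 1#)) (zeroˡ _)) ⟩
          (F₀ * s₁ + B * F₁ * s₀ + H) + 0#
            -- Zero returns as `u * p₂ * s₁` minus itself: one copy completes the right-hand side of
            -- `F-solves`, the other goes into `G (suc n)`.
            ≈⟨ +-congˡ (trans (*-congʳ (-‿inverseʳ 1#)) (zeroˡ _)) ⟨
          (F₀ * s₁ + B * F₁ * s₀ + H) + (1# + - 1#) * (u * p₂ * s₁)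
            ≈⟨ solve 9 (λ B F₀ F₁ s₀ s₁ p₂ u ν H →
                 (F₀ :* s₁ :+ B :* F₁ :* s₀ :+ H) :+ (con 1 :+ ν) :* (u :* p₂ :* s₁)
                 := B :* F₁ :* s₀ :+ (F₀ :+ u :* p₂) :* s₁ :+ ν :* (u :* p₂) :* s₁ :+ H)
                 refl B F₀ F₁ s₀ s₁ p₂ u (- 1#) H ⟩
          B * F₁ * s₀ + (F₀ + u * p₂) * s₁ + - 1# * (u * p₂) * s₁ + H
            ≈⟨ +-congʳ (+-congʳ (+-congˡ (*-congʳ (F-solves n)))) ⟨
          B * F₁ * s₀ + (B * F₂ + A * F₁) * s₁ + - 1# * (u * p₂) * s₁ + H
            ≈⟨ solve 8 (λ A B F₁ F₂ s₀ s₁ v H →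
                 B :* F₁ :* s₀ :+ (B :* F₂ :+ A :* F₁) :* s₁ :+ v :* s₁ :+ H
                 := F₁ :* (A :* s₁ :+ B :* s₀) :+ (B :* F₂ :+ v) :* s₁ :+ H)
                 refl A B F₁ F₂ s₀ s₁ (- 1# * (u * p₂)) H ⟩
          F₁ * (A * s₁ + B * s₀) + G (suc n) * s₁ + H
            ≈⟨ +-congʳ (+-congʳ (*-congˡ (s-rec n))) ⟨
          F₁ * s (suc (suc n)) + G (suc n) * s₁ + H ∎
          where
          t : ℕ → K
          t k = p k * s (k ∸ 1)
          F₀ = F n
          F₁ = F (suc n)
          F₂ = F (suc (suc n))
          s₀ = s n
          s₁ = s (suc n)
          p₁ = p (suc n)
          p₂ = p (suc (suc n))

      -- Abstract so that checking against real numbers does not unfold the coefficients.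
      abstract

        polynomial-summation : ∀ e → (A + B) * e ≈ 1# + e → ∀ (s : ℕ → K) u →
          (∀ n → s (suc (suc n)) ≈ A * s (suc n) + B * s n) → ∀ P →
          ∃[ F₁ ] ∃[ G₁ ] ∃[ H₁ ] (∀ n →
            u * ∑ n (λ k → eval P (ι k) * s (k ∸ 1))
              ≈ eval F₁ (ι n) * s (suc n) + eval G₁ (ι n) * s n + eval H₁ (ι n))
        polynomial-summation e inv s u s-rec P
          with inhomogeneous-solution e inv
                 (polynomial-scale u (polynomial-shift (polynomial-shift (eval-polynomial P))))
        ... | F , PF , F-solves
          with coefficients PF
             | coefficients (polynomial-+ (polynomial-scale B (polynomial-shift PF))
                 (polynomial-scale (- 1#) (polynomial-scale u (polynomial-shift (eval-polynomial P)))))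
             | coefficients (horner (H s (eval P ∘ ι) F u s-rec F-solves) (null λ _ → refl)
                 (λ m → sym (trans (+-congˡ (zeroʳ (ι m))) (+-identityʳ _))))
        ... | F₁ , F≈F₁ | G₁ , G≈G₁ | H₁ , H≈H₁ = F₁ , G₁ , H₁ , λ n → trans
          (summation s (eval P ∘ ι) F u s-rec F-solves n)
          (+-cong (+-cong (*-congʳ (F≈F₁ n)) (*-congʳ (G≈G₁ n))) (H≈H₁ n))

open import Defs

-- Integers inside the rationals and reals.

-- `i / 1` normalizes by a gcd that is stuck for a variable `i`; the explicit fraction lets sums and
-- products compute.
/1≡mkℚ : ∀ i → i ℚ./ 1 ≡ mkℚ i 0 (Coprimality.sym (Coprimality.1-coprimeTo ℤ.∣ i ∣))
/1≡mkℚ i = ℚ.fromℚᵘ-toℚᵘ (mkℚ i 0 (Coprimality.sym (Coprimality.1-coprimeTo ℤ.∣ i ∣)))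

/1-homo-+ : ∀ i j → (i ℤ.+ j) ℚ./ 1 ≡ i ℚ./ 1 ℚ.+ j ℚ./ 1
/1-homo-+ i j rewrite /1≡mkℚ i | /1≡mkℚ j =
  ≡.cong (ℚ._/ 1) (≡.sym (≡.cong₂ ℤ._+_ (ℤ.*-identityʳ i) (ℤ.*-identityʳ j)))

/1-homo-* : ∀ i j → (i ℤ.* j) ℚ./ 1 ≡ (i ℚ./ 1) ℚ.* (j ℚ./ 1)
/1-homo-* i j rewrite /1≡mkℚ i | /1≡mkℚ j = ≡.refl

fib-rec : ∀ a b c₀ c₁ n → let s = λ k → fromℤ (fib a b c₀ c₁ k) in
          s (suc (suc n)) ≈ fromℕ a * s (suc n) + fromℕ b * s n
fib-rec a b c₀ c₁ n = pointwise λ _ →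
  let x = fib a b c₀ c₁ (suc n)
      y = fib a b c₀ c₁ n
  in ≡.trans (/1-homo-+ ((ℤ.+ a) ℤ.* x) ((ℤ.+ b) ℤ.* y))
             (≡.cong₂ ℚ._+_ (/1-homo-* (ℤ.+ a) x) (/1-homo-* (ℤ.+ b) y))

-- The equation says `e = (A + B - 1)⁻¹` without subtraction. After matching, `a` names the
-- predecessor of the first argument, so `q` is `A + B - 1`, a nonnegative number plus a positive
-- one.
a+b-1-invertible : ∀ a b → .{{NonZero a}} → .{{NonZero b}} →
                   ∃[ e ] (fromℕ a + fromℕ b) * e ≈ 1ℝ + e
a+b-1-invertible (suc a) (suc b) = fromℚ (ℚ.1/ q) , pointwise λ _ → begin
  (ℤ.+ suc a ℚ./ 1 ℚ.+ β) ℚ.* ℚ.1/ q     ≡⟨ ≡.cong (λ α → (α ℚ.+ β) ℚ.* ℚ.1/ q) (/1-homo-+ (ℤ.+ 1) (ℤ.+ a)) ⟩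
  (1ℚ ℚ.+ ℤ.+ a ℚ./ 1 ℚ.+ β) ℚ.* ℚ.1/ q  ≡⟨ ≡.cong (ℚ._* ℚ.1/ q) (ℚ.+-assoc 1ℚ (ℤ.+ a ℚ./ 1) β) ⟩
  (1ℚ ℚ.+ q) ℚ.* ℚ.1/ q                  ≡⟨ ℚ.*-distribʳ-+ (ℚ.1/ q) 1ℚ q ⟩
  1ℚ ℚ.* ℚ.1/ q ℚ.+ q ℚ.* ℚ.1/ q         ≡⟨ ≡.cong₂ ℚ._+_ (ℚ.*-identityˡ (ℚ.1/ q)) (ℚ.*-inverseʳ q) ⟩
  ℚ.1/ q ℚ.+ 1ℚ                          ≡⟨ ℚ.+-comm (ℚ.1/ q) 1ℚ ⟩
  1ℚ ℚ.+ ℚ.1/ q                          ∎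
  where
  open ≡.≡-Reasoning
  β q : ℚ
  β = ℤ.+ suc b ℚ./ 1
  q = ℤ.+ a ℚ./ 1 ℚ.+ β
  instance
    q≢0 : ℚ.NonZero q
    q≢0 = ℚ.pos⇒nonZero q {{ℚ.nonNeg+pos⇒pos (ℤ.+ a ℚ./ 1) {{ℚ.normalize-nonNeg a 1}}
                                              β {{ℚ.normalize-pos (suc b) 1}}}}

open Summation ℝ-commutativeRing using (polynomial-summation)

theorem3p1 :
    (a b : ℕ) .{{_ : NonZero a}} .{{_ : NonZero b}}
    (c₀ c₁ : ℤ) → (c₀ , c₁) ≢ (0ℤ , 0ℤ) →
    let s : ℕ → ℝ
        s n = fromℤ (fib a b c₀ c₁ n)
    in
    (P : ℝ[X]) →
    ∃[ F₁ ] ∃[ G₁ ] ∃[ H₁ ] ((n : ℕ) .{{_ : NonZero n}} →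
      fromℕ 2 * ∑₁ n (λ k → P ⟨ fromℕ k ⟩ * s (k ∸ 1))
        ≈ F₁ ⟨ fromℕ n ⟩ * s (suc n) + G₁ ⟨ fromℕ n ⟩ * s n + H₁ ⟨ fromℕ n ⟩)
theorem3p1 a b c₀ c₁ _ P =
  -- pointwise and mk≈ ∘ close make Agda match the two readings of the ring operations on
  -- rational sequences; on reals it would also compare Cauchy proofs.
  let (e , inv)           = a+b-1-invertible a b
      (F₁ , G₁ , H₁ , eq) = polynomial-summation
        fromℕ (λ m → pointwise λ _ → /1-homo-+ (ℤ.+ 1) (ℤ.+ m))
        _⟨_⟩ (λ _ → pointwise λ _ → ≡.refl) (λ _ _ _ → pointwise λ _ → ≡.refl)
        (fromℕ a) (fromℕ b) e (mk≈ (close inv))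
        (λ n → fromℤ (fib a b c₀ c₁ n)) (fromℕ 2) (λ n → mk≈ (close (fib-rec a b c₀ c₁ n))) P
  in F₁ , G₁ , H₁ , λ n → mk≈ (close (eq n))
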